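{- Let $G$ be a finite, simple, connected 3-regular graph. Then $\mathrm{tgndi}_{\Sigma}(G)\le 2$; that is, there exists a map $f:V(G)\cup E(G)\to\{1,2\}$ such that for every edge $uv\in E(G)$ we have $t(u)\ne t(v)$, where $t(v)=f(v)+\sum_{w\in N(v)} f(vw)$.
   Context: $N(v)$ denotes the set of neighbors of $v$. For a positive integer $k$, a total $k$-coloring of $G$ is a map $f:V(G)\cup E(G)\to[k]=\{1,\dots,k\}$; it is neighbor total sum distinguishing if $t(u)\ne t(v)$ for all adjacent $u,v$, where $t(v)=f(v)+\sum_{w\in N(v)}f(vw)$. $\mathrm{tgndi}_{\Sigma}(G)$ is the minimum $k$ for which such a total $k$-coloring exists. -}

module Defs where

import Data.Nat
open import Data.Nat using (ℕ; zero; suc; _+_)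
open import Data.Bool using (Bool; true; false; if_then_else_)
open import Data.Fin using (Fin)
open import Data.Nat.ListAction using (sum)
open import Data.List using (List; map; length; filterᵇ; allFin)
open import Data.Product using (_×_; Σ; ∃; _,_)
open import Relation.Binary.PropositionalEquality using (_≡_; _≢_)

record Graph (n : ℕ) : Set where
  field
    adj   : Fin n → Fin n → Bool
    sym   : ∀ u v → adj u v ≡ adj v u
    irrefl : ∀ v → adj v v ≡ false

open Graph public

N : ∀ {n} → Graph n → Fin n → List (Fin n)
N G v = filterᵇ (adj G v) (allFin _)

degree : ∀ {n} → Graph n → Fin n → ℕ
degree G v = length (N G v)

Regular : ∀ {n} → ℕ → Graph n → Set
Regular d G = ∀ v → degree G v ≡ d

data Reach {n} (G : Graph n) : Fin n → Fin n → Set where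
  here : ∀ {v} → Reach G v v
  step : ∀ {u w v} → adj G u w ≡ true → Reach G w v → Reach G u v

Connected : ∀ {n} → Graph n → Set
Connected G = ∀ u v → Reach G u v

-- A total coloring: vertex colors fv and edge colors fe, where the color of
-- edge uv is fe u v; fe must be symmetric on edges (an edge is unordered).
-- Colors lie in [k] = {1,…,k}.
record TotalColoring {n} (G : Graph n) (k : ℕ) : Set where
  field
    fv : Fin n → ℕ
    fe : Fin n → Fin n → ℕ
    fv-range : ∀ v → 1 Data.Nat.≤ fv v × fv v Data.Nat.≤ k
    fe-range : ∀ u v → adj G u v ≡ true → 1 Data.Nat.≤ fe u v × fe u v Data.Nat.≤ k
    fe-sym   : ∀ u v → adj G u v ≡ true → fe u v ≡ fe v u

open TotalColoring public

t : ∀ {n} {G : Graph n} {k} → TotalColoring G k → Fin n → ℕ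
t {G = G} c v = fv c v + sum (map (fe c v) (N G v))

NeighborSumDistinguishing : ∀ {n} {G : Graph n} {k} → TotalColoring G k → Set
NeighborSumDistinguishing {G = G} c = ∀ u v → adj G u v ≡ true → t c u ≢ t c v

{-# OPTIONS --safe #-}

-- Subtract 1 from all colours, so that they lie in {0,1}. Take a cut σ in which
-- every vertex has at most one neighbour on its own side (a locally maximal
-- cut); the edges inside the two sides then form a matching. Use the vertex
-- colours to make every total sum on one side even and on the other side odd:
-- only the matching edges remain to be distinguished. If u, v are matched and
-- the numbers c u, c v ≤ 2 of cross edges of colour 1 at u and v differ, then
-- one of the two colours for the edge uv separates their sums. To make c u and
-- c v differ in parity for all matched pairs, take the cross edges of a T-join
-- H, where T contains exactly one vertex of every pair. The T-join exists if
-- some vertex r is unmatched, since r can absorb the parity; if all vertices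
-- are matched then both sides have the same size and hence the same number of
-- pairs, so |T| is even.
module Submission where

open import Defs
open import Data.Nat using (ℕ)
open import Data.Product using (Σ)

open import Algebra.Bundles using (CommutativeMonoid; CommutativeRing)
import Algebra.Properties.CommutativeMonoid.Sum as MonoidSum
import Algebra.Properties.Semiring.Sum as SemiringSum
open import Data.Bool using (Bool; true; false; not; _∧_; _∨_; _xor_; if_then_else_)
open import Data.Bool.Properties using (xor-∧-commutativeRing; xor-same; xor-comm; ∨-comm; ∧-zeroʳ; ∧-identityʳ; ∧-distribˡ-xor)
open import Data.Fin as Fin using (Fin; zero; suc)
import Data.Fin.Properties as Fin
open import Data.List using (length; map; filterᵇ; tabulate)
open import Data.Nat using (zero; suc; _+_; _*_; _≤_; _<_; _≤?_; z≤n; s≤s; _≟_)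
open import Data.Nat.Induction using (<-wellFounded)
open import Data.Nat.ListAction using (sum)
open import Data.Nat.Properties
open import Data.Nat.Tactic.RingSolver using (solve-∀)
open import Data.Product using (_×_; _,_; proj₁; proj₂; ∃)
open import Function using (_∘_; id)
open import Induction.WellFounded using (Acc; acc)
open import Relation.Binary.Definitions using (tri<; tri≈; tri>)
open import Relation.Binary.PropositionalEquality using (_≡_; _≢_; refl; trans; cong; cong₂; subst; module ≡-Reasoning) renaming (sym to ≡-sym)
open import Relation.Nullary using (yes; no; does; contradiction)
open import Relation.Nullary.Decidable using (dec-true; dec-false)

-- Sums

module _ {a ℓ} (M : CommutativeMonoid a ℓ) where
  private module M = CommutativeMonoid M
  open M using (Carrier; _≈_; ε)
  open MonoidSum M renaming (sum to ∑)

  sum-zero : ∀ {n} {f : Fin n → Carrier} → (∀ i → f i ≈ ε) → ∑ f ≈ ε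
  sum-zero {n} f≈ε = M.trans (sum-cong-≋ f≈ε) (sum-replicate-zero n)

  sum-supported : ∀ {n} {f : Fin n → Carrier} i →
                  (∀ j → j ≢ i → f j ≈ ε) → ∑ f ≈ f i
  sum-supported {f = f} zero off =
    M.trans (M.∙-congˡ (sum-zero (λ j → off (suc j) λ ()))) (M.identityʳ (f zero))
  sum-supported {f = f} (suc i) off =
    M.trans (M.∙-cong (off zero λ ()) (sum-supported i λ j j≢i → off (suc j) (j≢i ∘ Fin.suc-injective)))
            (M.identityˡ (f (suc i)))

module ℕ-Sum = SemiringSum +-*-semiring
module 𝔽₂-Sum = SemiringSum (CommutativeRing.semiring xor-∧-commutativeRing)

open ℕ-Sum using () renaming (sum to ∑)
open 𝔽₂-Sum using () renaming (sum to ⨁)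

∑-supported : ∀ {n} {f : Fin n → ℕ} i → (∀ j → j ≢ i → f j ≡ 0) → ∑ f ≡ f i
∑-supported = sum-supported +-0-commutativeMonoid

⨁-zero : ∀ {n} {f : Fin n → Bool} → (∀ i → f i ≡ false) → ⨁ f ≡ false
⨁-zero = sum-zero (CommutativeRing.+-commutativeMonoid xor-∧-commutativeRing)

⨁-supported : ∀ {n} {f : Fin n → Bool} i → (∀ j → j ≢ i → f j ≡ false) → ⨁ f ≡ f i
⨁-supported = sum-supported (CommutativeRing.+-commutativeMonoid xor-∧-commutativeRing)

⟦_⟧ : Bool → ℕ
⟦ true ⟧  = 1
⟦ false ⟧ = 0

⟦⟧≤1 : ∀ b → ⟦ b ⟧ ≤ 1
⟦⟧≤1 true  = ≤-refl
⟦⟧≤1 false = z≤n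

⟦⟧-∧-≤ : ∀ a b → ⟦ a ∧ b ⟧ ≤ ⟦ a ⟧
⟦⟧-∧-≤ true  b = ⟦⟧≤1 b
⟦⟧-∧-≤ false b = z≤n

∑-mono-≤ : ∀ {n} {f g : Fin n → ℕ} → (∀ i → f i ≤ g i) → ∑ f ≤ ∑ g
∑-mono-≤ {zero}  f≤g = z≤n
∑-mono-≤ {suc n} f≤g = +-mono-≤ (f≤g zero) (∑-mono-≤ (f≤g ∘ suc))

term≤∑ : ∀ {n} (f : Fin n → ℕ) i → f i ≤ ∑ f
term≤∑ f zero    = m≤m+n (f zero) _
term≤∑ f (suc i) = ≤-trans (term≤∑ (f ∘ suc) i) (m≤n+m _ (f zero))

∑⟦⟧≤1-unique : ∀ {n} (p : Fin n → Bool) → ∑ (λ k → ⟦ p k ⟧) ≤ 1 →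
               ∀ {i} → p i ≡ true → ∀ j → j ≢ i → p j ≡ false
∑⟦⟧≤1-unique p ≤1 {zero} pi zero j≢i = contradiction refl j≢i
∑⟦⟧≤1-unique p ≤1 {zero} pi (suc j) j≢i with p (suc j) in pj
... | false = refl
... | true  = contradiction ≤1 (<⇒≱ (+-mono-≤ (≤-reflexive (≡-sym (cong ⟦_⟧ pi)))
    (subst (_≤ _) (cong ⟦_⟧ pj) (term≤∑ (λ k → ⟦ p (suc k) ⟧) j))))
∑⟦⟧≤1-unique p ≤1 {suc i} pi zero j≢i with p zero
... | false = refl
... | true  = contradiction ≤1 (<⇒≱ (s≤s
    (subst (_≤ _) (cong ⟦_⟧ pi) (term≤∑ (λ k → ⟦ p (suc k) ⟧) i))))
∑⟦⟧≤1-unique p ≤1 {suc i} pi (suc j) j≢i =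
  ∑⟦⟧≤1-unique (p ∘ suc) (≤-trans (m≤n+m _ ⟦ p zero ⟧) ≤1) pi j (j≢i ∘ cong suc)

odd : ℕ → Bool
odd zero    = false
odd (suc n) = not (odd n)

odd-+ : ∀ m n → odd (m + n) ≡ odd m xor odd n
odd-+ zero    n = refl
odd-+ (suc m) n rewrite odd-+ m n with odd m | odd n
... | true  | true  = refl
... | true  | false = refl
... | false | _     = refl

odd-⟦⟧ : ∀ b → odd ⟦ b ⟧ ≡ b
odd-⟦⟧ true  = refl
odd-⟦⟧ false = refl

odd-∑⟦⟧ : ∀ {n} (p : Fin n → Bool) → odd (∑ (λ i → ⟦ p i ⟧)) ≡ ⨁ p
odd-∑⟦⟧ {zero}  p = refl
odd-∑⟦⟧ {suc n} p =
  trans (odd-+ ⟦ p zero ⟧ _) (cong₂ _xor_ (odd-⟦⟧ (p zero)) (odd-∑⟦⟧ (p ∘ suc)))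

odd-∑ : ∀ {n} (f : Fin n → ℕ) → odd (∑ f) ≡ ⨁ (odd ∘ f)
odd-∑ {zero}  f = refl
odd-∑ {suc n} f = trans (odd-+ (f zero) _) (cong (odd (f zero) xor_) (odd-∑ (f ∘ suc)))

sum-filterᵇ : ∀ {n} {A : Set} (p : A → Bool) (f : A → ℕ) (g : Fin n → A) →
  sum (map f (filterᵇ p (tabulate g))) ≡ ∑ (λ i → if p (g i) then f (g i) else 0)
sum-filterᵇ {zero}  p f g = refl
sum-filterᵇ {suc n} p f g with p (g zero)
... | true  = cong (f (g zero) +_) (sum-filterᵇ p f (g ∘ suc))
... | false = sum-filterᵇ p f (g ∘ suc)

length-filterᵇ : ∀ {n} {A : Set} (p : A → Bool) (g : Fin n → A) →
  length (filterᵇ p (tabulate g)) ≡ ∑ (λ i → ⟦ p (g i) ⟧)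
length-filterᵇ {zero}  p g = refl
length-filterᵇ {suc n} p g with p (g zero)
... | true  = cong suc (length-filterᵇ p (g ∘ suc))
... | false = length-filterᵇ p (g ∘ suc)

infix 5 _==_

_==_ : ∀ {n} → Fin n → Fin n → Bool
i == j = does (i Fin.≟ j)

==-refl : ∀ {n} (i : Fin n) → (i == i) ≡ true
==-refl i = dec-true (i Fin.≟ i) refl

==-≢ : ∀ {n} {i j : Fin n} → i ≢ j → (i == j) ≡ false
==-≢ {i = i} {j} = dec-false (i Fin.≟ j)

-- T-joins

module _ {n : ℕ} (G : Graph n) where

  -- The edges that the walk uses an odd number of times, as a symmetric matrix over the two-element
  -- field. Repeated edges cancel, so walks are not reduced to paths.
  walkEdges : ∀ {u r} → Reach G u r → Fin n → Fin n → Bool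
  walkEdges here x y = false
  walkEdges (step {u} {w} _ p) x y =
    ((x == u) ∧ (y == w)) xor (((x == w) ∧ (y == u)) xor walkEdges p x y)

  walkEdges-sym : ∀ {u r} (p : Reach G u r) x y → walkEdges p x y ≡ walkEdges p y x
  walkEdges-sym here x y = refl
  walkEdges-sym (step {u} {w} _ p) x y rewrite walkEdges-sym p x y
    with x == u | y == w | x == w | y == u
  ... | true  | true  | true  | true  = refl
  ... | true  | true  | true  | false = refl
  ... | true  | true  | false | true  = refl
  ... | true  | true  | false | false = refl
  ... | true  | false | true  | true  = refl
  ... | true  | false | true  | false = refl
  ... | true  | false | false | true  = refl
  ... | true  | false | false | false = refl
  ... | false | true  | true  | true  = refl
  ... | false | true  | true  | false = refl
  ... | false | true  | false | true  = refl
  ... | false | true  | false | false = refl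
  ... | false | false | true  | true  = refl
  ... | false | false | true  | false = refl
  ... | false | false | false | true  = refl
  ... | false | false | false | false = refl

  edge≢nonedge : ∀ {u w x y} → adj G u w ≡ true → adj G x y ≡ false →
                 ((x == u) ∧ (y == w)) ≡ false
  edge≢nonedge {u} {w} {x} {y} uw ¬xy with x Fin.≟ u | y Fin.≟ w
  ... | no _     | _        = refl
  ... | yes _    | no _     = refl
  ... | yes refl | yes refl = contradiction (trans (≡-sym uw) ¬xy) λ ()

  walkEdges-adj : ∀ {u r} (p : Reach G u r) {x y} → adj G x y ≡ false → walkEdges p x y ≡ false
  walkEdges-adj here ¬xy = refl
  walkEdges-adj (step {u} {w} uw p) {x} {y} ¬xy
    rewrite walkEdges-adj p ¬xy | edge≢nonedge uw ¬xy
          | edge≢nonedge (trans (sym G w u) uw) ¬xy = refl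

  ⨁-∧-== : ∀ b (w : Fin n) → ⨁ (λ y → b ∧ (y == w)) ≡ b
  ⨁-∧-== b w = trans
    (⨁-supported w λ y y≢w → trans (cong (b ∧_) (==-≢ y≢w)) (∧-zeroʳ b))
    (trans (cong (b ∧_) (==-refl w)) (∧-identityʳ b))

  -- Each step toggles the degree parity of its two ends, so the interior of the walk telescopes
  -- away and only its two ends survive; for a closed walk these cancel too.
  walkEdges-boundary : ∀ {u r} (p : Reach G u r) x →
    ⨁ (walkEdges p x) ≡ (x == u) xor (x == r)
  walkEdges-boundary {u} here x = trans (⨁-zero {n} λ _ → refl) (≡-sym (xor-same (x == u)))
  walkEdges-boundary {u} {r} (step {w = w} _ p) x = begin
    ⨁ (λ y → ((x == u) ∧ (y == w)) xor (((x == w) ∧ (y == u)) xor walkEdges p x y))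
      ≡⟨ 𝔽₂-Sum.∑-distrib-+ (λ y → (x == u) ∧ (y == w)) _ ⟩
    ⨁ (λ y → (x == u) ∧ (y == w)) xor ⨁ (λ y → ((x == w) ∧ (y == u)) xor walkEdges p x y)
      ≡⟨ cong₂ _xor_ (⨁-∧-== (x == u) w) (𝔽₂-Sum.∑-distrib-+ (λ y → (x == w) ∧ (y == u)) _) ⟩
    (x == u) xor (⨁ (λ y → (x == w) ∧ (y == u)) xor ⨁ (walkEdges p x))
      ≡⟨ cong ((x == u) xor_) (cong₂ _xor_ (⨁-∧-== (x == w) u) (walkEdges-boundary p x)) ⟩
    (x == u) xor ((x == w) xor ((x == w) xor (x == r)))
      ≡⟨ cong ((x == u) xor_) (xor-cancel (x == w) (x == r)) ⟩
    (x == u) xor (x == r) ∎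
    where
    open ≡-Reasoning
    xor-cancel : ∀ a b → a xor (a xor b) ≡ b
    xor-cancel true  true  = refl
    xor-cancel true  false = refl
    xor-cancel false _     = refl

  module TJoin (conn : Connected G) (r : Fin n) (T : Fin n → Bool) where

    -- Superposes, modulo 2, one walk to the root from each vertex of `T`.
    join : Fin n → Fin n → Bool
    join x y = ⨁ (λ u → T u ∧ walkEdges (conn u r) x y)

    join-sym : ∀ x y → join x y ≡ join y x
    join-sym x y = 𝔽₂-Sum.sum-cong-≗ λ u → cong (T u ∧_) (walkEdges-sym (conn u r) x y)

    join-adj : ∀ {x y} → adj G x y ≡ false → join x y ≡ false
    join-adj ¬xy = ⨁-zero λ u → trans (cong (T u ∧_) (walkEdges-adj (conn u r) ¬xy)) (∧-zeroʳ (T u))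

    -- After exchanging the sums, every `u` in `T` contributes once at `u` and once at `r`. The
    -- contributions at `r` add up to the parity of `T`, so the root absorbs the defect when `T` is
    -- odd.
    join-boundary : ∀ x → ⨁ (join x) ≡ T x xor (⨁ T ∧ (x == r))
    join-boundary x = begin
      ⨁ (λ y → ⨁ (λ u → T u ∧ walkEdges (conn u r) x y))
        ≡⟨ 𝔽₂-Sum.∑-comm (λ y u → T u ∧ walkEdges (conn u r) x y) ⟩
      ⨁ (λ u → ⨁ (λ y → T u ∧ walkEdges (conn u r) x y))
        ≡⟨ 𝔽₂-Sum.sum-cong-≗ (λ u → ≡-sym (𝔽₂-Sum.*-distribˡ-sum (T u) (walkEdges (conn u r) x))) ⟩
      ⨁ (λ u → T u ∧ ⨁ (walkEdges (conn u r) x))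
        ≡⟨ 𝔽₂-Sum.sum-cong-≗ (λ u → trans (cong (T u ∧_) (walkEdges-boundary (conn u r) x))
                                           (∧-distribˡ-xor (T u) (x == u) (x == r))) ⟩
      ⨁ (λ u → (T u ∧ (x == u)) xor (T u ∧ (x == r)))
        ≡⟨ 𝔽₂-Sum.∑-distrib-+ (λ u → T u ∧ (x == u)) (λ u → T u ∧ (x == r)) ⟩
      ⨁ (λ u → T u ∧ (x == u)) xor ⨁ (λ u → T u ∧ (x == r))
        ≡⟨ cong₂ _xor_
             (trans (⨁-supported x (λ u u≢x → trans (cong (T u ∧_) (==-≢ (u≢x ∘ ≡-sym))) (∧-zeroʳ (T u))))
                    (trans (cong (T x ∧_) (==-refl x)) (∧-identityʳ (T x))))
             (≡-sym (𝔽₂-Sum.*-distribʳ-sum (x == r) T)) ⟩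
      T x xor (⨁ T ∧ (x == r)) ∎
      where open ≡-Reasoning

-- Cuts

module Cut {n : ℕ} (G : Graph n) (σ : Fin n → Bool) where

  inner cross : Fin n → Fin n → Bool
  inner u v = adj G u v ∧ not (σ u xor σ v)
  cross u v = adj G u v ∧ (σ u xor σ v)

  innerDegree crossDegree : Fin n → ℕ
  innerDegree u = ∑ (λ v → ⟦ inner u v ⟧)
  crossDegree u = ∑ (λ v → ⟦ cross u v ⟧)

  inner-sym : ∀ u v → inner u v ≡ inner v u
  inner-sym u v = cong₂ _∧_ (sym G u v) (cong not (xor-comm (σ u) (σ v)))

  inner-irrefl : ∀ u → inner u u ≡ false
  inner-irrefl u rewrite irrefl G u = refl

  inner-side : ∀ u v → inner u v ≡ true → σ u ≡ σ v
  inner-side u v uv with adj G u v | σ u | σ v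
  inner-side u v () | false | _     | _
  inner-side u v uv | true  | true  | true  = refl
  inner-side u v uv | true  | false | false = refl
  inner-side u v () | true  | true  | false
  inner-side u v () | true  | false | true

  1≤innerDegree : ∀ {u v} → inner u v ≡ true → 1 ≤ innerDegree u
  1≤innerDegree {u} {v} uv =
    subst (_≤ innerDegree u) (cong ⟦_⟧ uv) (term≤∑ (λ w → ⟦ inner u w ⟧) v)

  inner+cross : ∀ u → innerDegree u + crossDegree u ≡ ∑ (λ v → ⟦ adj G u v ⟧)
  inner+cross u = trans
    (≡-sym (ℕ-Sum.∑-distrib-+ (λ v → ⟦ inner u v ⟧) (λ v → ⟦ cross u v ⟧)))
    (ℕ-Sum.sum-cong-≗ λ v → split (adj G u v) (σ u xor σ v))
    where
    split : ∀ a b → ⟦ a ∧ not b ⟧ + ⟦ a ∧ b ⟧ ≡ ⟦ a ⟧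
    split true  true  = refl
    split true  false = refl
    split false _     = refl

  -- Ordered pairs are counted, so this is twice the number of edges inside the two sides.
  innerSize : ℕ
  innerSize = ∑ innerDegree

module _ {n : ℕ} (G : Graph n) where

  flip : (Fin n → Bool) → Fin n → Fin n → Bool
  flip σ v u = σ u xor (u == v)

  module _ (σ : Fin n → Bool) (v : Fin n) where
    open Cut G σ
    private module F = Cut G (flip σ v)

    -- Flipping `v` exchanges inner and cross exactly in row `v` and column `v`. The old inner terms
    -- stand on the left to avoid subtraction in ℕ. The diagonal entry at `v`, where row and column
    -- meet, vanishes since there are no loops.
    flip-inner : ∀ u w →
      ⟦ F.inner u w ⟧ + (⟦ (u == v) ∧ inner v w ⟧ + ⟦ (w == v) ∧ inner v u ⟧) ≡
      ⟦ inner u w ⟧ + (⟦ (u == v) ∧ cross v w ⟧ + ⟦ (w == v) ∧ cross v u ⟧)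
    flip-inner u w with u Fin.≟ v | w Fin.≟ v
    ... | yes refl | yes refl rewrite irrefl G v = refl
    ... | yes refl | no _ = lemma (adj G v w) (σ v) (σ w)
      where
      lemma : ∀ a s t → ⟦ a ∧ not ((s xor true) xor (t xor false)) ⟧ + (⟦ a ∧ not (s xor t) ⟧ + 0) ≡
                        ⟦ a ∧ not (s xor t) ⟧ + (⟦ a ∧ (s xor t) ⟧ + 0)
      lemma false _     _     = refl
      lemma true  true  true  = refl
      lemma true  true  false = refl
      lemma true  false true  = refl
      lemma true  false false = refl
    ... | no _ | yes refl rewrite sym G u v = lemma (adj G v u) (σ u) (σ v)
      where
      lemma : ∀ a s t → ⟦ a ∧ not ((s xor false) xor (t xor true)) ⟧ + ⟦ a ∧ not (t xor s) ⟧ ≡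
                        ⟦ a ∧ not (s xor t) ⟧ + ⟦ a ∧ (t xor s) ⟧
      lemma false _     _     = refl
      lemma true  true  true  = refl
      lemma true  true  false = refl
      lemma true  false true  = refl
      lemma true  false false = refl
    ... | no _ | no _ = lemma (adj G u w) (σ u) (σ w)
      where
      lemma : ∀ a s t → ⟦ a ∧ not ((s xor false) xor (t xor false)) ⟧ + 0 ≡ ⟦ a ∧ not (s xor t) ⟧ + 0
      lemma false _     _     = refl
      lemma true  true  true  = refl
      lemma true  true  false = refl
      lemma true  false true  = refl
      lemma true  false false = refl

    -- `f` is placed once along row `v` and once along column `v`, so its sum appears twice.
    ∑∑-at : ∀ (f : Fin n → Bool) (g : Fin n → Fin n → ℕ) →
      ∑ (λ u → ∑ (λ w → g u w + (⟦ (u == v) ∧ f w ⟧ + ⟦ (w == v) ∧ f u ⟧))) ≡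
      ∑ (λ u → ∑ (g u)) + (∑ (λ w → ⟦ f w ⟧) + ∑ (λ w → ⟦ f w ⟧))
    ∑∑-at f g = begin
      ∑ (λ u → ∑ (λ w → g u w + (row u w + row w u)))
        ≡⟨ ∑∑-+ g (λ u w → row u w + row w u) ⟩
      ∑ (λ u → ∑ (g u)) + ∑ (λ u → ∑ (λ w → row u w + row w u))
        ≡⟨ cong (∑ (λ u → ∑ (g u)) +_) (∑∑-+ row (λ u w → row w u)) ⟩
      ∑ (λ u → ∑ (g u)) + (∑ (λ u → ∑ (row u)) + ∑ (λ u → ∑ (λ w → row w u)))
        ≡⟨ cong (∑ (λ u → ∑ (g u)) +_) (cong₂ _+_ ∑∑row
             (trans (ℕ-Sum.∑-comm (λ u w → row w u)) ∑∑row)) ⟩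
      ∑ (λ u → ∑ (g u)) + (∑ (λ w → ⟦ f w ⟧) + ∑ (λ w → ⟦ f w ⟧)) ∎
      where
      open ≡-Reasoning
      row : Fin n → Fin n → ℕ
      row u w = ⟦ (u == v) ∧ f w ⟧
      ∑∑-+ : ∀ (g h : Fin n → Fin n → ℕ) →
        ∑ (λ u → ∑ (λ w → g u w + h u w)) ≡ ∑ (λ u → ∑ (g u)) + ∑ (λ u → ∑ (h u))
      ∑∑-+ g h = trans (ℕ-Sum.sum-cong-≗ λ u → ℕ-Sum.∑-distrib-+ (g u) (h u))
                       (ℕ-Sum.∑-distrib-+ (λ u → ∑ (g u)) (λ u → ∑ (h u)))
      ∑∑row : ∑ (λ u → ∑ (row u)) ≡ ∑ (λ w → ⟦ f w ⟧)
      ∑∑row = trans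
        (∑-supported v λ u u≢v → trans
          (ℕ-Sum.sum-cong-≗ λ w → cong (λ b → ⟦ b ∧ f w ⟧) (==-≢ u≢v))
          (sum-zero +-0-commutativeMonoid {n} λ _ → refl))
        (ℕ-Sum.sum-cong-≗ λ w → cong (λ b → ⟦ b ∧ f w ⟧) (==-refl v))

    flip-innerSize : F.innerSize + (innerDegree v + innerDegree v) ≡
                     innerSize + (crossDegree v + crossDegree v)
    flip-innerSize = trans
      (≡-sym (∑∑-at (inner v) (λ u w → ⟦ F.inner u w ⟧)))
      (trans (ℕ-Sum.sum-cong-≗ λ u → ℕ-Sum.sum-cong-≗ λ w → flip-inner u w)
             (∑∑-at (cross v) (λ u w → ⟦ inner u w ⟧)))

    flip-decreases : crossDegree v < innerDegree v → F.innerSize < innerSize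
    -- Otherwise the left side of `flip-innerSize` would strictly exceed the right side.
    flip-decreases c<i = ≰⇒> λ size≤ → <-irrefl (≡-sym flip-innerSize)
      (+-mono-≤-< size≤ (+-mono-< c<i c<i))

-- Matching cuts of cubic graphs

module Cubic {n : ℕ} (G : Graph n) (regular : Regular 3 G) where

  degree≡3 : ∀ v → ∑ (λ u → ⟦ adj G v u ⟧) ≡ 3
  degree≡3 v = trans (≡-sym (length-filterᵇ (adj G v) id)) (regular v)

  Matching : (Fin n → Bool) → Set
  Matching σ = ∀ v → Cut.innerDegree G σ v ≤ 1

  -- Local search: as long as some vertex has two inner neighbours it is flipped, and `innerSize`
  -- decreases.
  matchingCut : ∃ Matching
  matchingCut = search (λ _ → true) (<-wellFounded _)
    where
    search : ∀ σ → Acc _<_ (Cut.innerSize G σ) → ∃ Matching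
    search σ (acc rec) with Fin.any? (λ v → 2 ≤? Cut.innerDegree G σ v)
    ... | no none = σ , λ v → ≤-pred (≰⇒> λ 2≤ → none (v , 2≤))
    ... | yes (v , 2≤) = search (flip G σ v) (rec (flip-decreases G σ v
            -- If the cross degree were no smaller than the inner degree, the degree would be at
            -- least 2 + 2, but it is 3.
            (≰⇒> λ i≤c → contradiction
              (≤-trans (+-mono-≤ 2≤ (≤-trans 2≤ i≤c))
                       (≤-reflexive (trans (Cut.inner+cross G σ v) (degree≡3 v))))
              λ { (s≤s (s≤s (s≤s ()))) })))

  module _ (σ : Fin n → Bool) where
    open Cut G σ

    -- Orients inner edges from the smaller to the larger index, so that each pair is counted once.
    lower : Fin n → Fin n → Bool
    lower u v = inner u v ∧ does (u Fin.<? v)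

    -- For a matching cut this marks the smaller end of each pair; it is the set `T` of the join.
    -- Written as a sum modulo 2, it needs no search for the partner.
    leader : Fin n → Bool
    leader u = ⨁ (lower u)

    -- Parity of the number of pairs when every vertex is matched

    module _ (perfect : ∀ v → innerDegree v ≡ 1) where

      onSide : Bool → Fin n → ℕ
      onSide s u = ⟦ not (σ u xor s) ⟧

      side : Bool → ℕ
      side s = ∑ (onSide s)

      lowerDegree : Fin n → ℕ
      lowerDegree u = ∑ (λ v → ⟦ lower u v ⟧)

      leaders : Bool → ℕ
      leaders s = ∑ (λ u → onSide s u * lowerDegree u)

      crossDegree≡2 : ∀ v → crossDegree v ≡ 2
      crossDegree≡2 v = suc-injective (trans (cong (_+ crossDegree v) (≡-sym (perfect v)))
                                             (trans (inner+cross v) (degree≡3 v)))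

      -- Both ends of a pair lie on the same side and exactly one of them has the smaller index.
      -- Counting inner edges from all vertices of the side therefore meets each pair once from its
      -- smaller and once from its larger end.
      side≡2*leaders : ∀ s → side s ≡ leaders s + leaders s
      side≡2*leaders s = begin
        ∑ (onSide s)
          ≡⟨ ℕ-Sum.sum-cong-≗ (λ u → trans (≡-sym (*-identityʳ (onSide s u))) (cong (onSide s u *_) (≡-sym (perfect u)))) ⟩
        ∑ (λ u → onSide s u * innerDegree u)
          ≡⟨ ℕ-Sum.sum-cong-≗ (λ u → ℕ-Sum.*-distribˡ-sum (onSide s u) (λ v → ⟦ inner u v ⟧)) ⟩
        ∑ (λ u → ∑ (λ v → onSide s u * ⟦ inner u v ⟧))
          ≡⟨ ℕ-Sum.sum-cong-≗ (λ u → trans (ℕ-Sum.sum-cong-≗ (λ v → split u v)) (ℕ-Sum.∑-distrib-+ (low u) (λ v → low v u))) ⟩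
        ∑ (λ u → ∑ (low u) + ∑ (λ v → low v u))
          ≡⟨ ℕ-Sum.∑-distrib-+ (λ u → ∑ (low u)) (λ u → ∑ (λ v → low v u)) ⟩
        ∑ (λ u → ∑ (low u)) + ∑ (λ u → ∑ (λ v → low v u))
          ≡⟨ cong₂ _+_ ∑∑low (trans (ℕ-Sum.∑-comm (λ u v → low v u)) ∑∑low) ⟩
        leaders s + leaders s ∎
        where
        open ≡-Reasoning
        low : Fin n → Fin n → ℕ
        low u v = onSide s u * ⟦ lower u v ⟧
        ∑∑low : ∑ (λ u → ∑ (low u)) ≡ leaders s
        ∑∑low = ℕ-Sum.sum-cong-≗ λ u → ≡-sym (ℕ-Sum.*-distribˡ-sum (onSide s u) (λ v → ⟦ lower u v ⟧))
        split : ∀ u v → onSide s u * ⟦ inner u v ⟧ ≡ low u v + low v u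
        split u v rewrite inner-sym v u with inner u v in uv
        ... | false = trans (*-zeroʳ (onSide s u))
                        (≡-sym (cong₂ _+_ (*-zeroʳ (onSide s u)) (*-zeroʳ (onSide s v))))
        ... | true rewrite inner-side u v uv with Fin.<-cmp u v
        ...   | tri< u<v _ v≮u rewrite dec-true (u Fin.<? v) u<v | dec-false (v Fin.<? u) v≮u
                = ≡-sym (trans (cong (onSide s v * 1 +_) (*-zeroʳ (onSide s v))) (+-identityʳ _))
        ...   | tri≈ _ refl _ = contradiction (trans (≡-sym uv) (inner-irrefl u)) λ ()
        ...   | tri> u≮v _ v<u rewrite dec-false (u Fin.<? v) u≮v | dec-true (v Fin.<? u) v<u
                = ≡-sym (cong (_+ onSide s v * 1) (*-zeroʳ (onSide s v)))

      -- Double counting of cross edges: every vertex lies on two of them, and each has one end on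
      -- either side.
      sides-equal : side true ≡ side false
      sides-equal = *-cancelʳ-≡ (side true) (side false) 2 (begin
        side true * 2
          ≡⟨ double true ⟩
        ∑ (λ u → ∑ (λ v → onSide true u * ⟦ cross u v ⟧))
          ≡⟨ ℕ-Sum.sum-cong-≗ (λ u → ℕ-Sum.sum-cong-≗ (λ v → opposite u v)) ⟩
        ∑ (λ u → ∑ (λ v → onSide false v * ⟦ cross v u ⟧))
          ≡⟨ ℕ-Sum.∑-comm (λ u v → onSide false v * ⟦ cross v u ⟧) ⟩
        ∑ (λ v → ∑ (λ u → onSide false v * ⟦ cross v u ⟧))
          ≡⟨ double false ⟨
        side false * 2 ∎)
        where
        open ≡-Reasoning
        double : ∀ s → side s * 2 ≡ ∑ (λ u → ∑ (λ v → onSide s u * ⟦ cross u v ⟧))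
        double s = trans (ℕ-Sum.*-distribʳ-sum 2 (onSide s)) (ℕ-Sum.sum-cong-≗ λ u →
          trans (cong (onSide s u *_) (≡-sym (crossDegree≡2 u)))
                (ℕ-Sum.*-distribˡ-sum (onSide s u) (λ v → ⟦ cross u v ⟧)))
        opposite : ∀ u v → onSide true u * ⟦ cross u v ⟧ ≡ onSide false v * ⟦ cross v u ⟧
        opposite u v rewrite sym G v u with adj G u v | σ u | σ v
        ... | false | true  | true  = refl
        ... | false | true  | false = refl
        ... | false | false | true  = refl
        ... | false | false | false = refl
        ... | true  | true  | true  = refl
        ... | true  | true  | false = refl
        ... | true  | false | true  = refl
        ... | true  | false | false = refl

      -- Sides of equal size contain equally many pairs, so the total number of pairs is twice that
      -- of one side.
      leaders-even : ⨁ leader ≡ false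
      leaders-even = begin
        ⨁ leader
          ≡⟨ 𝔽₂-Sum.sum-cong-≗ (λ u → odd-∑⟦⟧ (lower u)) ⟨
        ⨁ (odd ∘ lowerDegree)
          ≡⟨ odd-∑ lowerDegree ⟨
        odd (∑ lowerDegree)
          ≡⟨ cong odd (ℕ-Sum.sum-cong-≗ λ u → partition (σ u) (lowerDegree u)) ⟩
        odd (∑ (λ u → onSide true u * lowerDegree u + onSide false u * lowerDegree u))
          ≡⟨ cong odd (ℕ-Sum.∑-distrib-+ (λ u → onSide true u * lowerDegree u) _) ⟩
        odd (leaders true + leaders false)
          ≡⟨ cong (λ k → odd (leaders true + k)) (≡-sym leaders-equal) ⟩
        odd (leaders true + leaders true)
          ≡⟨ trans (odd-+ (leaders true) _) (xor-same (odd (leaders true))) ⟩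
        false ∎
        where
        open ≡-Reasoning
        partition : ∀ b k → k ≡ ⟦ not (b xor true) ⟧ * k + ⟦ not (b xor false) ⟧ * k
        partition true  k = ≡-sym (trans (+-identityʳ _) (+-identityʳ k))
        partition false k = ≡-sym (+-identityʳ k)
        2*k : ∀ k → k * 2 ≡ k + k
        2*k = solve-∀
        leaders-equal : leaders true ≡ leaders false
        leaders-equal = *-cancelʳ-≡ _ _ 2 (begin
          leaders true * 2              ≡⟨ 2*k (leaders true) ⟩
          leaders true + leaders true   ≡⟨ side≡2*leaders true ⟨
          side true                     ≡⟨ sides-equal ⟩
          side false                    ≡⟨ side≡2*leaders false ⟩
          leaders false + leaders false ≡⟨ 2*k (leaders false) ⟨
          leaders false * 2             ∎)

    -- Separating the matched pairs by a T-join

    module _ (matching : Matching σ) where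

      partner-unique : ∀ {u v} → inner u v ≡ true → ∀ w → w ≢ v → inner u w ≡ false
      partner-unique {u} = ∑⟦⟧≤1-unique (inner u) (matching u)

      ∑-inner : ∀ {u v} → inner u v ≡ true → ∀ (p : Fin n → Bool) →
                ∑ (λ w → ⟦ inner u w ∧ p w ⟧) ≡ ⟦ p v ⟧
      ∑-inner {u} {v} uv p = trans
        (∑-supported v λ w w≢v → cong (λ b → ⟦ b ∧ p w ⟧) (partner-unique uv w w≢v))
        (cong (λ b → ⟦ b ∧ p v ⟧) uv)

      ⨁-inner : ∀ {u v} → inner u v ≡ true → ∀ (p : Fin n → Bool) →
                ⨁ (λ w → inner u w ∧ p w) ≡ p v
      ⨁-inner {u} {v} uv p = trans (≡-sym (odd-∑⟦⟧ (λ w → inner u w ∧ p w)))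
                                   (trans (cong odd (∑-inner uv p)) (odd-⟦⟧ (p v)))

      -- The sums over inner neighbours collapse to the only partner, and exactly one of `u < v` and
      -- `v < u` holds.
      leader-xor : ∀ {u v} → inner u v ≡ true → leader u xor leader v ≡ true
      leader-xor {u} {v} uv
        rewrite ⨁-inner uv (λ w → does (u Fin.<? w))
              | ⨁-inner (trans (inner-sym v u) uv) (λ w → does (v Fin.<? w))
        with Fin.<-cmp u v
      ... | tri< u<v _ v≮u rewrite dec-true (u Fin.<? v) u<v | dec-false (v Fin.<? u) v≮u = refl
      ... | tri≈ _ refl _ = contradiction (trans (≡-sym uv) (inner-irrefl u)) λ ()
      ... | tri> u≮v _ v<u rewrite dec-false (u Fin.<? v) u≮v | dec-true (v Fin.<? u) v<u = refl

      -- The defect at the root must not disturb a matched vertex. If all vertices are matched,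
      -- `⨁ leader` vanishes and any root works. Otherwise a vertex of inner degree other than 1 is
      -- an end of no inner edge and can serve as root.
      root : Fin n → ∃ λ r → ∀ {u v} → inner u v ≡ true → ⨁ leader ∧ (u == r) ≡ false
      root r₀ with Fin.all? (λ v → innerDegree v ≟ 1)
      ... | yes perfect = r₀ , λ {u} _ → cong (_∧ (u == r₀)) (leaders-even perfect)
      ... | no ¬perfect with Fin.¬∀⟶∃¬ n _ (λ v → innerDegree v ≟ 1) ¬perfect
      ...   | r , ≢1 = r , λ {u} {v} uv → trans (cong (⨁ leader ∧_) 
                (==-≢ {i = u} {r} λ { refl → ≢1 (≤-antisym (matching r) (1≤innerDegree uv)) }))
                (∧-zeroʳ (⨁ leader))

      crossCount : (Fin n → Fin n → Bool) → Fin n → ℕ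
      crossCount H u = ∑ (λ v → ⟦ cross u v ∧ H u v ⟧)

      Separating : (Fin n → Fin n → Bool) → Set
      Separating H = ∀ {u v} → inner u v ≡ true → crossCount H u ≢ crossCount H v

      separatingJoin : Connected G → Fin n → ∃ λ H → (∀ u v → H u v ≡ H v u) × Separating H
      separatingJoin conn r₀ = join , join-sym , separating
        where
        r = proj₁ (root r₀)
        open TJoin G conn r leader

        -- Row `u` of the join splits into its cross part and a single inner entry, the one at the
        -- partner `v`; the defect of `join-boundary` vanishes at `u` by the choice of `r`.
        odd-crossCount : ∀ {u v} → inner u v ≡ true → odd (crossCount join u) xor join u v ≡ leader u
        odd-crossCount {u} {v} uv = begin
          odd (crossCount join u) xor join u v
            ≡⟨ cong₂ _xor_ (odd-∑⟦⟧ (λ w → cross u w ∧ join u w)) (≡-sym (⨁-inner uv (join u))) ⟩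
          ⨁ (λ w → cross u w ∧ join u w) xor ⨁ (λ w → inner u w ∧ join u w)
            ≡⟨ 𝔽₂-Sum.∑-distrib-+ (λ w → cross u w ∧ join u w) (λ w → inner u w ∧ join u w) ⟨
          ⨁ (λ w → (cross u w ∧ join u w) xor (inner u w ∧ join u w))
            ≡⟨ 𝔽₂-Sum.sum-cong-≗ (λ w → recombine (adj G u w) (σ u xor σ w) (join u w) join-adj) ⟩
          ⨁ (join u)
            ≡⟨ join-boundary u ⟩
          leader u xor (⨁ leader ∧ (u == r))
            ≡⟨ cong (leader u xor_) (proj₂ (root r₀) uv) ⟩
          leader u xor false
            ≡⟨ xor-comm (leader u) false ⟩
          leader u ∎
          where
          open ≡-Reasoning
          recombine : ∀ a b c → (a ≡ false → c ≡ false) →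
                      ((a ∧ b) ∧ c) xor ((a ∧ not b) ∧ c) ≡ c
          recombine true  true  true  _ = refl
          recombine true  true  false _ = refl
          recombine true  false _     _ = refl
          recombine false _     _     h = ≡-sym (h refl)

        separating : Separating join
        separating {u} {v} uv c≡ = contradiction
          (trans (≡-sym (leader-xor uv)) (trans (cong (leader u xor_) (≡-sym leaders≡)) (xor-same (leader u))))
          λ ()
          where
          leaders≡ : leader u ≡ leader v
          leaders≡ = trans (≡-sym (odd-crossCount uv))
            -- Whether the join contains the inner edge itself affects both ends alike, so equal
            -- cross counts would give equal leaders.
            (trans (cong₂ _xor_ (cong odd c≡) (join-sym u v))
                   (odd-crossCount (trans (inner-sym v u) uv)))

-- Choosing the colours

-- Rounds `d` up to parity `s`. With `d` the sum of the edge bits at a vertex, the amount added is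
-- the bit of the vertex colour.
settle : Bool → ℕ → ℕ
settle s d = d + ⟦ odd d xor s ⟧

odd-settle : ∀ s d → odd (settle s d) ≡ s
odd-settle s d rewrite odd-+ d ⟦ odd d xor s ⟧ | odd-⟦⟧ (odd d xor s) with odd d | s
... | true  | true  = refl
... | true  | false = refl
... | false | _     = refl

isZero : ℕ → Bool
isZero zero    = true
isZero (suc _) = false

-- Adding w to two distinct numbers in {0,1,2} and rounding up to parity s
-- merges 1 with 2 (s even) or 0 with 1 (s odd) if w = 0, and vice versa if w = 1.
separator : Bool → ℕ → ℕ → Bool
separator s c d = not (s xor (isZero c ∨ isZero d))

separator-sym : ∀ s c d → separator s c d ≡ separator s d c
separator-sym s c d = cong (λ z → not (s xor z)) (∨-comm (isZero c) (isZero d))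

-- Two distinct values in {0,1,2} either include 0, and then merging 1 with 2 is harmless, or they
-- are 1 and 2, and then merging 0 with 1 is harmless. `separator` picks the harmless rounding.
settle-separator : ∀ s {c d} → c ≤ 2 → d ≤ 2 → c ≢ d →
  settle s (c + ⟦ separator s c d ⟧) ≢ settle s (d + ⟦ separator s c d ⟧)
settle-separator s     z≤n             z≤n             c≢d = contradiction refl c≢d
settle-separator s     (s≤s z≤n)       (s≤s z≤n)       c≢d = contradiction refl c≢d
settle-separator s     (s≤s (s≤s z≤n)) (s≤s (s≤s z≤n)) c≢d = contradiction refl c≢d
settle-separator true  z≤n             (s≤s z≤n)       c≢d = λ ()
settle-separator true  z≤n             (s≤s (s≤s z≤n)) c≢d = λ ()
settle-separator true  (s≤s z≤n)       z≤n             c≢d = λ ()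
settle-separator true  (s≤s z≤n)       (s≤s (s≤s z≤n)) c≢d = λ ()
settle-separator true  (s≤s (s≤s z≤n)) z≤n             c≢d = λ ()
settle-separator true  (s≤s (s≤s z≤n)) (s≤s z≤n)       c≢d = λ ()
settle-separator false z≤n             (s≤s z≤n)       c≢d = λ ()
settle-separator false z≤n             (s≤s (s≤s z≤n)) c≢d = λ ()
settle-separator false (s≤s z≤n)       z≤n             c≢d = λ ()
settle-separator false (s≤s z≤n)       (s≤s (s≤s z≤n)) c≢d = λ ()
settle-separator false (s≤s (s≤s z≤n)) z≤n             c≢d = λ ()
settle-separator false (s≤s (s≤s z≤n)) (s≤s z≤n)       c≢d = λ ()

-- The total colouring and its sums

module Colouring {n : ℕ} (G : Graph n) (regular : Regular 3 G) (σ : Fin n → Bool)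
                 (matching : Cubic.Matching G regular σ) (H : Fin n → Fin n → Bool)
                 (H-sym : ∀ u v → H u v ≡ H v u)
                 (separating : Cubic.Separating G regular σ matching H) where
  open Cubic G regular
  open Cut G σ

  c : Fin n → ℕ
  c = crossCount σ matching H

  -- The bits of inner edges depend only on the sides and on `c`, which counts cross edges, so the
  -- choices for different pairs do not interact.
  edgeBit : Fin n → Fin n → Bool
  edgeBit u v = if σ u xor σ v then H u v else separator (σ u) (c u) (c v)

  edgeBit-sym : ∀ u v → edgeBit u v ≡ edgeBit v u
  edgeBit-sym u v = swap (σ u) (σ v) (H-sym u v)
    where
    swap : ∀ a b {h h′} → h ≡ h′ →
      (if a xor b then h else separator a (c u) (c v)) ≡
      (if b xor a then h′ else separator b (c v) (c u))
    swap true  true  _ = separator-sym true (c u) (c v)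
    swap true  false h = h
    swap false true  h = h
    swap false false _ = separator-sym false (c u) (c v)

  bitDegree : Fin n → ℕ
  bitDegree u = ∑ (λ v → ⟦ adj G u v ∧ edgeBit u v ⟧)

  bit-range : ∀ b → 1 ≤ suc ⟦ b ⟧ × suc ⟦ b ⟧ ≤ 2
  bit-range b = s≤s z≤n , s≤s (⟦⟧≤1 b)

  colouring : TotalColoring G 2
  colouring = record
    -- The bit is the correction made by `settle`: it gives the sum of all bits at `v` the parity of
    -- its side.
    { fv       = λ v → suc ⟦ odd (bitDegree v) xor σ v ⟧
    ; fe       = λ u v → suc ⟦ edgeBit u v ⟧
    ; fv-range = λ v → bit-range (odd (bitDegree v) xor σ v)
    ; fe-range = λ u v _ → bit-range (edgeBit u v)
    ; fe-sym   = λ u v _ → cong (suc ∘ ⟦_⟧) (edgeBit-sym u v)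
    }

  -- The constant 4 collects the shifts by 1 of the vertex colour and of the three edge colours.
  t-colouring : ∀ v → t colouring v ≡ 4 + settle (σ v) (bitDegree v)
  t-colouring v = begin
    suc x + sum (map (fe colouring v) (N G v))
      ≡⟨ cong (suc x +_) (sum-filterᵇ (adj G v) (fe colouring v) id) ⟩
    suc x + ∑ (λ u → if adj G v u then suc ⟦ edgeBit v u ⟧ else 0)
      ≡⟨ cong (suc x +_) (ℕ-Sum.sum-cong-≗ (λ u → split (adj G v u) (edgeBit v u))) ⟩
    suc x + ∑ (λ u → ⟦ adj G v u ⟧ + ⟦ adj G v u ∧ edgeBit v u ⟧)
      ≡⟨ cong (suc x +_) (ℕ-Sum.∑-distrib-+ (λ u → ⟦ adj G v u ⟧) _) ⟩
    suc x + (∑ (λ u → ⟦ adj G v u ⟧) + bitDegree v)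
      ≡⟨ cong (λ k → suc x + (k + bitDegree v)) (degree≡3 v) ⟩
    suc x + (3 + bitDegree v)
      ≡⟨ rearrange x (bitDegree v) ⟩
    4 + (bitDegree v + x) ∎
    where
    open ≡-Reasoning
    x = ⟦ odd (bitDegree v) xor σ v ⟧
    split : ∀ a b → (if a then suc ⟦ b ⟧ else 0) ≡ ⟦ a ⟧ + ⟦ a ∧ b ⟧
    split true  b = refl
    split false b = refl
    rearrange : ∀ x d → suc x + (3 + d) ≡ 4 + (d + x)
    rearrange = solve-∀

  -- The cross edges contribute `c u`, and the matching leaves only the partner among the inner
  -- terms.
  bitDegree-inner : ∀ {u v} → inner u v ≡ true →
    bitDegree u ≡ c u + ⟦ separator (σ u) (c u) (c v) ⟧
  bitDegree-inner {u} {v} uv = begin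
    bitDegree u
      ≡⟨ ℕ-Sum.sum-cong-≗ (λ w → split (adj G u w) (σ u xor σ w) (H u w) (separator (σ u) (c u) (c w))) ⟩
    ∑ (λ w → ⟦ cross u w ∧ H u w ⟧ + ⟦ inner u w ∧ separator (σ u) (c u) (c w) ⟧)
      ≡⟨ ℕ-Sum.∑-distrib-+ (λ w → ⟦ cross u w ∧ H u w ⟧) _ ⟩
    c u + ∑ (λ w → ⟦ inner u w ∧ separator (σ u) (c u) (c w) ⟧)
      ≡⟨ cong (c u +_) (∑-inner σ matching uv (λ w → separator (σ u) (c u) (c w))) ⟩
    c u + ⟦ separator (σ u) (c u) (c v) ⟧ ∎
    where
    open ≡-Reasoning
    split : ∀ a b h w → ⟦ a ∧ (if b then h else w) ⟧ ≡ ⟦ (a ∧ b) ∧ h ⟧ + ⟦ (a ∧ not b) ∧ w ⟧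
    split true  true  h w = ≡-sym (+-identityʳ ⟦ h ⟧)
    split true  false h w = refl
    split false _     h w = refl

  -- One of the three edges at `u` is inner, which leaves at most two cross edges.
  c≤2 : ∀ {u v} → inner u v ≡ true → c u ≤ 2
  c≤2 {u} {v} uv = ≤-trans (∑-mono-≤ λ w → ⟦⟧-∧-≤ (cross u w) (H u w))
    (≤-pred (≤-trans (+-monoˡ-≤ (crossDegree u)
                       (1≤innerDegree uv))
                     (≤-reflexive (trans (inner+cross u) (degree≡3 u)))))

  -- Both ends have the same side and see the same bit on their common edge, so `settle-separator`
  -- applies to their cross counts.
  settle-inner : ∀ {u v} → inner u v ≡ true →
    settle (σ u) (bitDegree u) ≢ settle (σ v) (bitDegree v)
  settle-inner {u} {v} uv eq =
    settle-separator (σ u) (c≤2 uv) (c≤2 vu) (separating uv) (begin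
      settle (σ u) (c u + ⟦ separator (σ u) (c u) (c v) ⟧)
        ≡⟨ cong (settle (σ u)) (bitDegree-inner uv) ⟨
      settle (σ u) (bitDegree u)
        ≡⟨ eq ⟩
      settle (σ v) (bitDegree v)
        ≡⟨ cong (settle (σ v)) (bitDegree-inner vu) ⟩
      settle (σ v) (c v + ⟦ separator (σ v) (c v) (c u) ⟧)
        ≡⟨ cong (λ s → settle s (c v + ⟦ separator s (c v) (c u) ⟧)) (inner-side v u vu) ⟩
      settle (σ u) (c v + ⟦ separator (σ u) (c v) (c u) ⟧)
        ≡⟨ cong (λ b → settle (σ u) (c v + ⟦ b ⟧)) (separator-sym (σ u) (c v) (c u)) ⟩
      settle (σ u) (c v + ⟦ separator (σ u) (c u) (c v) ⟧) ∎)
    where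
    open ≡-Reasoning
    vu = trans (inner-sym v u) uv

  -- Cross edges are distinguished by parity alone: equal sums have equal parity, which puts both
  -- ends on the same side, and the edge is then inner.
  distinguishing : NeighborSumDistinguishing colouring
  distinguishing u v uv t≡ = settle-inner inner-uv settle≡
    where
    settle≡ : settle (σ u) (bitDegree u) ≡ settle (σ v) (bitDegree v)
    settle≡ = +-cancelˡ-≡ 4 _ _ (trans (≡-sym (t-colouring u)) (trans t≡ (t-colouring v)))
    σ≡ : σ u ≡ σ v
    σ≡ = trans (≡-sym (odd-settle (σ u) (bitDegree u)))
               (trans (cong odd settle≡) (odd-settle (σ v) (bitDegree v)))
    inner-uv : inner u v ≡ true
    inner-uv rewrite uv | σ≡ | xor-same (σ v) = refl

theorem5 : ∀ {n} (G : Graph n) → Regular 3 G → Connected G →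
    Σ (TotalColoring G 2) (λ c → NeighborSumDistinguishing c)
-- Without vertices there is no candidate for the root of the join, so this case is separate.
theorem5 {zero} G regular conn = record
  { fv = λ () ; fe = λ () ; fv-range = λ () ; fe-range = λ () ; fe-sym = λ () } , λ ()
theorem5 {suc n} G regular conn = colouring , distinguishing
  where
  open Cubic G regular
  σ = proj₁ matchingCut
  matching = proj₂ matchingCut
  -- `zero` is the fallback root for the case in which every vertex is matched.
  H = separatingJoin σ matching conn zero
  open Colouring G regular σ matching (proj₁ H) (proj₁ (proj₂ H)) (proj₂ (proj₂ H))
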